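{- Let $\mathcal G'_3$, $\tau$, $\mathcal G'_6$ and $\mathcal B$ be as in the context. There is a first-order sentence $\psi$ in the signature $\Gamma_6\cup\{<\}$ which is $(\mathcal G'_6,\mathcal B)$-invariant and such that for every $(G,x,y,z)\in\mathcal G'_3$: if $x,y,z$ lie in one connected component and $d(x,y)=d(x,z)$, then $G^\tau\models(\mathfrak B<)\psi$; if $x,y,z$ do not all lie in one connected component, or $|d(x,y)-d(x,z)|\ge 2$, then $G^\tau\models\neg(\mathfrak B<)\psi$.
   Context: Graphs are finite and undirected; $d$ denotes graph distance. A linear order $<$ of the vertex set of a graph, listing vertices $v_1<\dots<v_n$, is a breadth-first traversal (BFT) if for each $i\ge2$, whenever some $v_j$ with $j<i$ has a neighbour outside $\{v_1,\dots,v_{i-1}\}$, $v_i$ is adjacent to $v_{j^*}$ for the least such $j^*$ (i.e. $<$ is a visiting order of breadth-first search). Equivalently: for all $u<v<w$, $uEw$ implies some $x<v$ with $x\le u$ has $xEv$. $\Gamma_n$ is the signature with a binary relation symbol $E$ and $n$ constant symbols; an $n$-pointed graph is a graph with $n$ distinguished vertices. $\mathcal G'_3$ is the family of finite 3-pointed graphs $(G,x,y,z)$ such that, if $x,y,z$ lie in the same connected component, then $|d(x,y)-d(x,z)|\neq 1$. For a 3-pointed graph $(G,x,y,z)$, $G^\tau$ is the 6-pointed graph obtained from two disjoint copies $G_1,G_2$ of $G$ (each with edges inherited from $G$) by adding a single edge between $x_1$ and $x_2$, where $x_i,y_i,z_i$ denote the copies of $x,y,z$ in $G_i$; its constants are $x_1,y_1,z_1,x_2,y_2,z_2$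 (this is given by a 2-dimensional quantifier-free interpretation $\tau:\Gamma_6\to\Gamma_3$). $\mathcal G'_6=\{G^\tau: G\in\mathcal G'_3\}$, and $\mathcal B$ is the family of all expansions $(H,<)$ with $H\in\mathcal G'_6$ and $<$ a BFT of $H$. A $\Gamma_6\cup\{<\}$-sentence $\psi$ is $(\mathcal G'_6,\mathcal B)$-invariant if $(H,<)\models\psi\iff(H',<')\models\psi$ for all $(H,<),(H',<')\in\mathcal B$ with $H\cong H'$. For such $\psi$ and $H\in\mathcal G'_6$, $H\models(\mathfrak B<)\psi$ means $(H,<)\models\psi$ for some (equivalently every) BFT $<$ of $H$. -}

module Defs where

open import Data.Empty using (⊥)
open import Data.Fin using (Fin)
open import Data.Fin.Patterns using (0F; 1F; 2F)
import Data.Fin.Properties as Fin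
open import Data.Fin.Properties using (+↔⊎)
open import Data.Nat using (ℕ; suc; _+_; _≤_; ∣_-_∣)
open import Data.Product using (∃; ∃-syntax; _×_; _,_)
open import Data.Sum using (_⊎_; inj₁; inj₂)
open import Data.Sum.Function.Propositional using (_⊎-↔_)
open import Data.Vec using (Vec; []; _∷_; _++_; lookup; map)
open import Function.Bundles using (_↔_; _⇔_; Inverse)
open import Function.Properties.Inverse using (Inverse⇒Injection; ↔-sym; ↔-trans)
open import Level using (0ℓ)
open import Relation.Binary.Core using (Rel)
open import Relation.Binary.Definitions using (Decidable; DecidableEquality; Irreflexive; Symmetric)
open import Relation.Binary.PropositionalEquality using (_≡_; refl)
open import Relation.Binary.Structures using (IsStrictTotalOrder)
open import Relation.Nullary using (¬_)
open import Relation.Nullary.Decidable using (_×-dec_; via-injection)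

record Graph : Set₁ where
  field
    V       : Set
    finite  : ∃[ n ] (V ↔ Fin n)
    E       : Rel V 0ℓ
    E?      : Decidable E
    sym     : Symmetric E
    irrefl  : Irreflexive _≡_ E

  _≟_ : DecidableEquality V
  _≟_ = let (_ , V↔Fin) = finite in via-injection (Inverse⇒Injection V↔Fin) Fin._≟_

  data Walk : V → V → ℕ → Set where
    nil  : ∀ {u} → Walk u u 0
    cons : ∀ {u v w k} → E u v → Walk v w k → Walk u w (suc k)

  Connected : Rel V 0ℓ
  Connected u v = ∃[ k ] Walk u v k

  -- The graph of the partial function d: d(u , v) is defined and equal to k.
  d[_,_]≡_ : V → V → ℕ → Set
  d[ u , v ]≡ k = Walk u v k × (∀ m → Walk u v m → k ≤ m)

  -- Some neighbour of u lies outside { w ∣ w < v }.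
  HasNeighbourOutside : Rel V 0ℓ → V → V → Set
  HasNeighbourOutside _<_ v u = ∃[ w ] (E u w × ¬ (w < v))

  -- With v = vᵢ, the set { v₁ , … , vᵢ₋₁ } is { w ∣ w < v }, and j below is v_{j*}.
  -- For the least vertex of the order (i = 1) the second component is vacuous.
  IsBFT : Rel V 0ℓ → Set
  IsBFT _<_ =
    IsStrictTotalOrder _≡_ _<_ ×
    (∀ v j → j < v → HasNeighbourOutside _<_ v j →
       (∀ j′ → j′ < j → ¬ HasNeighbourOutside _<_ v j′) →
       E v j)

-- The distinguished vertices interpret constant symbols, so they may coincide.
record PointedGraph (n : ℕ) : Set₁ where
  field
    graph  : Graph
    points : Vec (Graph.V graph) n
  open Graph graph public

record _≅_ {n} (H H′ : PointedGraph n) : Set where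
  private
    module H  = PointedGraph H
    module H′ = PointedGraph H′
  field
    bijection : H.V ↔ H′.V
  open Inverse bijection using (to)
  field
    edges     : ∀ u v → H.E u v ⇔ H′.E (to u) (to v)
    constants : map to H.points ≡ H′.points

-- First-order logic over Γ_c ∪ {<}; formulas are well-scoped, with de Bruijn
-- index 0 for the innermost bound variable.

data Term (c n : ℕ) : Set where
  var   : Fin n → Term c n
  const : Fin c → Term c n

infix  8 _≐_ _~_ _≺_
infixr 6 _∧̇_
infixr 5 _∨̇_
infixr 4 _⇒̇_

data Formula (c n : ℕ) : Set where
  _≐_           : Term c n → Term c n → Formula c n
  _~_           : Term c n → Term c n → Formula c n    -- E
  _≺_           : Term c n → Term c n → Formula c n    -- <
  ⊥̇             : Formula c n
  ¬̇_            : Formula c n → Formula c n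
  _∧̇_ _∨̇_ _⇒̇_   : Formula c n → Formula c n → Formula c n
  ∀̇_ ∃̇_         : Formula c (suc n) → Formula c n

Sentence : ℕ → Set
Sentence c = Formula c 0

-- Tarski semantics in (H , <). Since H is finite and E and every strict total
-- order < are decidable, satisfaction is decidable and agrees with the
-- classical notion.
module Semantics {c} (H : PointedGraph c) (_<_ : Rel (PointedGraph.V H) 0ℓ) where
  open PointedGraph H

  ⟦_⟧ₜ : ∀ {n} → Term c n → Vec V n → V
  ⟦ var i   ⟧ₜ ρ = lookup ρ i
  ⟦ const i ⟧ₜ ρ = lookup points i

  ⟦_⟧ : ∀ {n} → Formula c n → Vec V n → Set
  ⟦ s ≐ t ⟧ ρ = ⟦ s ⟧ₜ ρ ≡ ⟦ t ⟧ₜ ρ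
  ⟦ s ~ t ⟧ ρ = E (⟦ s ⟧ₜ ρ) (⟦ t ⟧ₜ ρ)
  ⟦ s ≺ t ⟧ ρ = ⟦ s ⟧ₜ ρ < ⟦ t ⟧ₜ ρ
  ⟦ ⊥̇ ⟧     ρ = ⊥
  ⟦ ¬̇ φ ⟧   ρ = ¬ ⟦ φ ⟧ ρ
  ⟦ φ ∧̇ χ ⟧ ρ = ⟦ φ ⟧ ρ × ⟦ χ ⟧ ρ
  ⟦ φ ∨̇ χ ⟧ ρ = ⟦ φ ⟧ ρ ⊎ ⟦ χ ⟧ ρ
  ⟦ φ ⇒̇ χ ⟧ ρ = ⟦ φ ⟧ ρ → ⟦ χ ⟧ ρ
  ⟦ ∀̇ φ ⟧   ρ = ∀ v → ⟦ φ ⟧ (v ∷ ρ)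
  ⟦ ∃̇ φ ⟧   ρ = ∃[ v ] ⟦ φ ⟧ (v ∷ ρ)

infix 3 _,_⊨_
_,_⊨_ : ∀ {c} (H : PointedGraph c) → Rel (PointedGraph.V H) 0ℓ → Sentence c → Set
H , _<_ ⊨ ψ = Semantics.⟦_⟧ H _<_ ψ []

module _ (G : PointedGraph 3) where
  open PointedGraph G

  private
    x y z : V
    x = lookup points 0F
    y = lookup points 1F
    z = lookup points 2F

  InOneComponent : Set
  InOneComponent = Connected x y × Connected x z

  -- d(x , y) and d(x , z) are both defined, and equal.
  Equidistant : Set
  Equidistant = ∃[ k ] (d[ x , y ]≡ k × d[ x , z ]≡ k)

  -- d(x , y) and d(x , z) are both defined, and |d(x , y) − d(x , z)| = k.
  DistanceGap : ℕ → Set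
  DistanceGap k = ∃[ a ] ∃[ b ] (d[ x , y ]≡ a × d[ x , z ]≡ b × ∣ a - b ∣ ≡ k)

  𝒢′₃ : Set
  𝒢′₃ = InOneComponent → ¬ DistanceGap 1

  -- inj₁ and inj₂ are the copies G₁ and G₂; the mixed clauses are the edge x₁x₂.
  Eτ : Rel (V ⊎ V) 0ℓ
  Eτ (inj₁ u) (inj₁ v) = E u v
  Eτ (inj₁ u) (inj₂ v) = u ≡ x × v ≡ x
  Eτ (inj₂ u) (inj₁ v) = u ≡ x × v ≡ x
  Eτ (inj₂ u) (inj₂ v) = E u v

  private
    finiteτ : ∃[ n ] ((V ⊎ V) ↔ Fin n)
    finiteτ = let (n , V↔Fin) = finite in
      n + n , ↔-trans (V↔Fin ⊎-↔ V↔Fin) (↔-sym +↔⊎)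

    Eτ? : Decidable Eτ
    Eτ? (inj₁ u) (inj₁ v) = E? u v
    Eτ? (inj₁ u) (inj₂ v) = (u ≟ x) ×-dec (v ≟ x)
    Eτ? (inj₂ u) (inj₁ v) = (u ≟ x) ×-dec (v ≟ x)
    Eτ? (inj₂ u) (inj₂ v) = E? u v

    symτ : Symmetric Eτ
    symτ {inj₁ u} {inj₁ v} e       = sym e
    symτ {inj₁ u} {inj₂ v} (p , q) = q , p
    symτ {inj₂ u} {inj₁ v} (p , q) = q , p
    symτ {inj₂ u} {inj₂ v} e       = sym e

    irreflτ : Irreflexive _≡_ Eτ
    irreflτ {inj₁ u} refl e = irrefl refl e
    irreflτ {inj₂ u} refl e = irrefl refl e

  -- The constants are x₁ , y₁ , z₁ , x₂ , y₂ , z₂, in this order.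
  _^τ : PointedGraph 6
  _^τ = record
    { graph  = record
      { V      = V ⊎ V
      ; finite = finiteτ
      ; E      = Eτ
      ; E?     = Eτ?
      ; sym    = λ {u} {v} → symτ {u} {v}
      ; irrefl = λ {u} {v} → irreflτ {u} {v}
      }
    ; points = map inj₁ points ++ map inj₂ points
    }

data 𝒢′₆ : PointedGraph 6 → Set₁ where
  image : ∀ G → 𝒢′₃ G → 𝒢′₆ (G ^τ)

𝓑 : (H : PointedGraph 6) → Rel (PointedGraph.V H) 0ℓ → Set₁
𝓑 H _<_ = 𝒢′₆ H × PointedGraph.IsBFT H _<_

Invariant : Sentence 6 → Set₁
Invariant ψ =
  ∀ H _<_ H′ _<′_ → 𝓑 H _<_ → 𝓑 H′ _<′_ → H ≅ H′ →
  (H , _<_ ⊨ ψ) ⇔ (H′ , _<′_ ⊨ ψ)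

infix 3 _⊨𝔅_
_⊨𝔅_ : PointedGraph 6 → Sentence 6 → Set₁
H ⊨𝔅 ψ = ∃[ _<_ ] (PointedGraph.IsBFT H _<_ × (H , _<_ ⊨ ψ))

{-# OPTIONS --safe #-}

-- Let < be a BFT of G^τ with, say, x₁ < x₂. The search then enters the second
-- copy of the component of x through x₂, so it visits that copy in the order
-- of the distance from x₂. If y₂ < z₂, the neighbour of z₂ one level closer to
-- x₂ precedes y₂ when y₂ and z₂ are equidistant from x₂, whereas no neighbour
-- of z₂ precedes y₂ when z₂ is at least two levels further. As the component of
-- a vertex is an interval of <, and a vertex starts a component iff it has no
-- smaller neighbour, being in the component of x₂ is also first-order definable.

module Submission where

open import Defs
open import Data.Empty using (⊥; ⊥-elim)
open import Data.Fin using (Fin)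
open import Data.Fin.Induction using (spo-wellFounded)
open import Data.Fin.Patterns using (0F; 1F; 2F; 3F; 4F; 5F)
import Data.Fin.Properties as Fin
open import Data.List using (List; []; _∷_; filter; length; map; allFin)
open import Data.List.Membership.Propositional using (_∈_; _∉_; lose)
open import Data.List.Membership.Propositional.Properties using (∈-filter⁺; ∈-map⁺; ∈-allFin)
open import Data.List.Properties using (filter-notAll)
open import Data.List.Relation.Unary.Any using (here; there; any?)
open import Data.Nat as ℕ using (ℕ; zero; suc; _≤_; ∣_-_∣; z≤n; s≤s)
import Data.Nat.Induction as ℕ
import Data.Nat.Properties as ℕ
open import Data.Product using (∃; ∃-syntax; _×_; _,_; proj₁; proj₂)
open import Data.Sum using (_⊎_; inj₁; inj₂)
open import Data.Sum.Properties using (inj₁-injective; inj₂-injective)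
import Data.Vec as Vec
open import Data.Vec using ([]; _∷_)
open import Data.Vec.Properties using (lookup-map)
open import Function using (_∘_; _on_)
open import Function.Bundles using (_⇔_; mk⇔; Equivalence; Inverse)
open import Function.Properties.Equivalence using () renaming (sym to ⇔-sym; trans to ⇔-trans)
open import Induction.WellFounded using (WellFounded; Acc; acc; module Subrelation)
open import Level using (0ℓ)
import Relation.Binary.Construct.On as On
open import Relation.Binary.Core using (Rel)
open import Relation.Binary.Definitions using (tri<; tri≈; tri>)
open import Relation.Binary.PropositionalEquality using (_≡_; _≢_; refl; sym; trans; cong; subst; subst₂; isEquivalence)
open import Relation.Binary.Structures using (IsStrictTotalOrder)
open import Relation.Nullary using (¬_; Dec; yes; no)
open import Relation.Nullary.Decidable using (map′; _×-dec_; ¬?)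
open import Relation.Unary using (Pred)
import Relation.Unary as U

-- Walks and distances

module FiniteGraph (g : Graph) where
  open Graph g renaming (sym to E-sym)
  open Inverse (proj₂ finite) using (to; from; strictlyInverseʳ)

  ∃? : {P : Pred V 0ℓ} → U.Decidable P → Dec (∃ P)
  ∃? {P} P? = map′
    (λ (i , p) → from i , p)
    (λ (v , p) → to v , subst P (sym (strictlyInverseʳ v)) p)
    (Fin.any? (P? ∘ from))

  vertices : List V
  vertices = map from (allFin (proj₁ finite))

  ∈-vertices : ∀ v → v ∈ vertices
  ∈-vertices v = subst (_∈ vertices) (strictlyInverseʳ v) (∈-map⁺ from (∈-allFin (to v)))

  sto⇒wellFounded : {_<_ : Rel V 0ℓ} → IsStrictTotalOrder _≡_ _<_ → WellFounded _<_
  sto⇒wellFounded {_<_} sto = Subrelation.wellFounded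
    (λ {u} {v} → subst₂ _<_ (sym (strictlyInverseʳ u)) (sym (strictlyInverseʳ v)))
    (On.wellFounded to (spo-wellFounded {_⊏_ = _<_ on from} record
      { isEquivalence = isEquivalence
      ; irrefl        = λ { refl → irr refl }
      ; trans         = tr
      ; <-resp-≈      = (λ { refl p → p }) , (λ { refl p → p })
      }))
    where open IsStrictTotalOrder sto using () renaming (irrefl to irr; trans to tr)

  snoc : ∀ {u v w k} → Walk u v k → E v w → Walk u w (suc k)
  snoc nil        f = cons f nil
  snoc (cons e p) f = cons e (snoc p f)

  reverse : ∀ {u v k} → Walk u v k → Walk v u k
  reverse nil        = nil
  reverse (cons e p) = snoc (reverse p) (E-sym e)

  connected-sym : ∀ {u v} → Connected u v → Connected v u
  connected-sym (_ , p) = _ , reverse p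

  connected-trans : ∀ {u v w} → Connected u v → Connected v w → Connected u w
  connected-trans (_ , nil)      q = q
  connected-trans (_ , cons e p) q = _ , cons e (proj₂ (connected-trans (_ , p) q))

  adjacent⇒connected : ∀ {u v} → E u v → Connected u v
  adjacent⇒connected e = 1 , cons e nil

  Walk? : ∀ u v k → Dec (Walk u v k)
  Walk? u v zero    = map′ (λ { refl → nil }) (λ { nil → refl }) (u ≟ v)
  Walk? u v (suc k) = map′
    (λ (_ , e , p) → cons e p)
    (λ { (cons e p) → _ , e , p })
    (∃? λ w → E? u w ×-dec Walk? w v k)

  distance : ∀ {u v} → Connected u v → ∃[ k ] d[ u , v ]≡ k
  distance {u} {v} (k , p) = least k (ℕ.<-wellFounded k) p
    where
    least : ∀ k → Acc ℕ._<_ k → Walk u v k → ∃[ m ] d[ u , v ]≡ m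
    least k (acc rec) p with ℕ.anyUpTo? (Walk? u v) k
    ... | yes (m , m<k , q) = least m (rec m<k) q
    ... | no  none          = k , p , λ m q → ℕ.≮⇒≥ λ m<k → none (m , m<k , q)

  distance-sym : ∀ {u v k} → d[ u , v ]≡ k → d[ v , u ]≡ k
  distance-sym (p , min) = reverse p , λ m q → min m (reverse q)

  distance-unique : ∀ {u v k m} → d[ u , v ]≡ k → d[ u , v ]≡ m → k ≡ m
  distance-unique (p , min) (q , min′) = ℕ.≤-antisym (min _ q) (min′ _ p)

  EquidistantFrom : V → V → V → Set
  EquidistantFrom x y z = ∃[ k ] (d[ x , y ]≡ k × d[ x , z ]≡ k)

-- `walk⁻` allows a shorter walk because folding the two copies of a doubled graph together
-- contracts the linking edge. Distances are still preserved and reflected.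
record Isometric (g h : Graph) (f : Graph.V g → Graph.V h) : Set where
  private
    module g = Graph g
    module h = Graph h
  field
    walk⁺ : ∀ {u v k} → g.Walk u v k → h.Walk (f u) (f v) k
    walk⁻ : ∀ {u v k} → h.Walk (f u) (f v) k → ∃[ m ] (m ≤ k × g.Walk u v m)

  distance⁺ : ∀ {u v k} → g.d[ u , v ]≡ k → h.d[ f u , f v ]≡ k
  distance⁺ (p , min) = walk⁺ p , λ m q →
    let (m′ , m′≤m , q′) = walk⁻ q in ℕ.≤-trans (min m′ q′) m′≤m

  distance⁻ : ∀ {u v k} → h.d[ f u , f v ]≡ k → g.d[ u , v ]≡ k
  distance⁻ {u} {v} (p , min) =
    let (m , m≤k , q) = walk⁻ p
    in subst (g.Walk u v) (ℕ.≤-antisym m≤k (min m (walk⁺ q))) q ,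
       λ m q → min m (walk⁺ q)

  connected⁻ : ∀ {u v} → h.Connected (f u) (f v) → g.Connected u v
  connected⁻ (_ , p) = let (_ , _ , q) = walk⁻ p in _ , q

  equidistant : ∀ {x y z} →
    FiniteGraph.EquidistantFrom g x y z ⇔ FiniteGraph.EquidistantFrom h (f x) (f y) (f z)
  equidistant = mk⇔
    (λ (k , p , q) → k , distance⁺ p , distance⁺ q)
    (λ (k , p , q) → k , distance⁻ p , distance⁻ q)

-- Every finite graph has a BFT

module Existence (g : Graph) where
  open Graph g renaming (sym to E-sym)
  open FiniteGraph g

  _∈?_ : ∀ v L → Dec (v ∈ L)
  v ∈? L = any? (v ≟_) L

  -- Lists hold the visited vertices, most recent first.
  Before : List V → Rel V 0ℓ
  Before []      u v = ⊥
  Before (w ∷ L) u v = (v ≡ w × u ∈ L) ⊎ Before L u v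

  HasUnvisitedNeighbour : List V → V → Set
  HasUnvisitedNeighbour L u = ∃[ w ] (E u w × w ∉ L)

  First : List V → Pred V 0ℓ → V → Set
  First L Q j = Q j × (∀ i → Before L i j → ¬ Q i)

  -- The premise of `step` is the BFT condition at the moment `v` is visited, with `L` as its
  -- predecessors. It is vacuous when no visited vertex has an unvisited neighbour; a new component
  -- may then start anywhere.
  data Traversal : List V → Set where
    []   : Traversal []
    step : ∀ {v L} → v ∉ L →
           (∀ j → j ∈ L → First L (HasUnvisitedNeighbour L) j → E v j) →
           Traversal L → Traversal (v ∷ L)

  before⇒∈ˡ : ∀ {L u v} → Before L u v → u ∈ L
  before⇒∈ˡ {w ∷ L} (inj₁ (_ , u∈L)) = there u∈L
  before⇒∈ˡ {w ∷ L} (inj₂ u<v)       = there (before⇒∈ˡ u<v)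

  before⇒∈ʳ : ∀ {L u v} → Before L u v → v ∈ L
  before⇒∈ʳ {w ∷ L} (inj₁ (refl , _)) = here refl
  before⇒∈ʳ {w ∷ L} (inj₂ u<v)        = there (before⇒∈ʳ u<v)

  before-irrefl : ∀ {L u} → Traversal L → ¬ Before L u u
  before-irrefl (step v∉L _ t) (inj₁ (refl , u∈L)) = v∉L u∈L
  before-irrefl (step v∉L _ t) (inj₂ u<u)          = before-irrefl t u<u

  before-trans : ∀ {L u v w} → Traversal L → Before L u v → Before L v w → Before L u w
  before-trans (step x∉L _ t) (inj₁ (refl , _)) (inj₁ (refl , v∈L)) = ⊥-elim (x∉L v∈L)
  before-trans (step x∉L _ t) (inj₁ (refl , _)) (inj₂ v<w) = ⊥-elim (x∉L (before⇒∈ˡ v<w))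
  before-trans (step x∉L _ t) (inj₂ u<v) (inj₁ (refl , _)) = inj₁ (refl , before⇒∈ˡ u<v)
  before-trans (step x∉L _ t) (inj₂ u<v) (inj₂ v<w)        = inj₂ (before-trans t u<v v<w)

  before-total : ∀ {L u v} → u ∈ L → v ∈ L → Before L u v ⊎ u ≡ v ⊎ Before L v u
  before-total (here refl) (here refl) = inj₂ (inj₁ refl)
  before-total (here refl) (there v∈L) = inj₂ (inj₂ (inj₁ (refl , v∈L)))
  before-total (there u∈L) (here refl) = inj₁ (inj₁ (refl , u∈L))
  before-total (there u∈L) (there v∈L) with before-total u∈L v∈L
  ... | inj₁ u<v        = inj₁ (inj₂ u<v)
  ... | inj₂ (inj₁ u≡v) = inj₂ (inj₁ u≡v)
  ... | inj₂ (inj₂ v<u) = inj₂ (inj₂ (inj₂ v<u))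

  complete⇒sto : ∀ {L} → Traversal L → (∀ v → v ∈ L) → IsStrictTotalOrder _≡_ (Before L)
  complete⇒sto t all = record
    { isStrictPartialOrder = record
      { isEquivalence = isEquivalence
      ; irrefl        = λ { refl → before-irrefl t }
      ; trans         = before-trans t
      ; <-resp-≈      = (λ { refl p → p }) , (λ { refl p → p })
      }
    ; compare = λ u v → compare′ (before-total (all u) (all v))
    }
    where
    asym : ∀ {u v} → Before _ u v → ¬ Before _ v u
    asym u<v v<u = before-irrefl t (before-trans t u<v v<u)

    compare′ : ∀ {u v} → Before _ u v ⊎ u ≡ v ⊎ Before _ v u → _
    compare′ (inj₁ u<v)         = tri< u<v (λ { refl → before-irrefl t u<v }) (asym u<v)
    compare′ (inj₂ (inj₁ refl)) = tri≈ (before-irrefl t) refl (before-irrefl t)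
    compare′ (inj₂ (inj₂ v<u))  = tri> (asym v<u) (λ { refl → before-irrefl t v<u }) v<u

  -- For the newest vertex the predecessors are exactly the members of `L`, so `next` applies. For
  -- an earlier `v` induction applies, since a vertex visited later never comes before `v`.
  traversal⇒bft : ∀ {L} → Traversal L → ∀ v j → Before L j v →
    HasNeighbourOutside (Before L) v j →
    (∀ i → Before L i j → ¬ HasNeighbourOutside (Before L) v i) → E v j
  traversal⇒bft (step v∉L next t) v j (inj₁ (refl , j∈L)) (w , jw , w≮v) first =
    next j j∈L ((w , jw , w≮v ∘ inj₁ ∘ (refl ,_)) ,
      λ i i<j (w′ , iw′ , w′∉L) → first i (inj₂ i<j)
        (w′ , iw′ , λ { (inj₁ (_ , w′∈L)) → w′∉L w′∈L
                      ; (inj₂ w′<v)       → w′∉L (before⇒∈ˡ w′<v) }))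
  traversal⇒bft (step x∉L next t) v j (inj₂ j<v) (w , jw , w≮v) first =
    traversal⇒bft t v j j<v (w , jw , w≮v ∘ inj₂)
      λ i i<j (w′ , iw′ , w′≮v) → first i (inj₂ i<j)
        (w′ , iw′ , λ { (inj₁ (refl , _)) → x∉L (before⇒∈ʳ j<v)
                      ; (inj₂ w′<v)       → w′≮v w′<v })

  -- The tail is searched before the head because it holds the earlier vertices. Uniqueness is
  -- returned because `step` demands an edge to every first element.
  first? : ∀ {Q : Pred V 0ℓ} → U.Decidable Q → ∀ L →
    (∃[ j ] (j ∈ L × Q j × (∀ i → i ∈ L → First L Q i → i ≡ j))) ⊎ (∀ i → i ∈ L → ¬ Q i)
  first? Q? []      = inj₂ λ _ ()
  first? Q? (w ∷ L) with first? Q? L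
  ... | inj₁ (j , j∈L , qj , only) = inj₁ (j , there j∈L , qj , λ where
          i (here refl) (_ , first)  → ⊥-elim (first j (inj₁ (refl , j∈L)) qj)
          i (there i∈L) (qi , first) → only i i∈L (qi , λ i′ i′<i → first i′ (inj₂ i′<i)))
  ... | inj₂ none with Q? w
  ...   | yes qw = inj₁ (w , here refl , qw , λ where
            i (here i≡w)  _        → i≡w
            i (there i∈L) (qi , _) → ⊥-elim (none i i∈L qi))
  ...   | no ¬qw = inj₂ λ where
            i (here refl) → ¬qw
            i (there i∈L) → none i i∈L

  extend : ∀ {L u} → u ∉ L → Traversal L → ∃[ v ] (v ∉ L × Traversal (v ∷ L))
  extend {L} {u} u∉L t with first? (λ j → ∃? λ w → E? j w ×-dec ¬? (w ∈? L)) L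
  ... | inj₁ (j , _ , (v , jv , v∉L) , only) =
          v , v∉L , step v∉L (λ i i∈L f → subst (E v) (sym (only i i∈L f)) (E-sym jv)) t
  ... | inj₂ none = u , u∉L , step u∉L (λ i i∈L (q , _) → ⊥-elim (none i i∈L q)) t

  -- `R` contains every unvisited vertex; deleting the newly visited one shortens it, which drives
  -- the recursion.
  complete : ∀ {L} R → Acc ℕ._<_ (length R) → (∀ v → v ∉ L → v ∈ R) → Traversal L →
    ∃[ L′ ] (Traversal L′ × (∀ v → v ∈ L′))
  complete {L} R (acc rec) rest t with ∃? (λ u → ¬? (u ∈? L))
  ... | no none = L , t , λ v → case v (v ∈? L)
    where
    case : ∀ v → Dec (v ∈ L) → v ∈ L
    case v (yes v∈L) = v∈L
    case v (no  v∉L) = ⊥-elim (none (v , v∉L))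
  ... | yes (u , u∉L) with extend u∉L t
  ...   | v , v∉L , t′ = complete (filter ≢v? R)
            (rec (filter-notAll ≢v? R (lose (rest v v∉L) λ v≢v → v≢v refl)))
            (λ w w∉vL → ∈-filter⁺ ≢v? (rest w (w∉vL ∘ there)) (w∉vL ∘ here))
            t′
    where
    ≢v? : U.Decidable (_≢ v)
    ≢v? w = ¬? (w ≟ v)

  bft-exists : ∃ IsBFT
  bft-exists with complete vertices (ℕ.<-wellFounded _) (λ v _ → ∈-vertices v) []
  ... | L , t , all = Before L , complete⇒sto t all , traversal⇒bft t

-- Components and levels of a BFT

module BFT (h : Graph) (_<_ : Rel (Graph.V h) 0ℓ) (bft : Graph.IsBFT h _<_) where
  open Graph h renaming (sym to E-sym)
  open FiniteGraph h
  open IsStrictTotalOrder (proj₁ bft) public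
    using (compare; _<?_; asym) renaming (trans to <-trans; irrefl to <-irrefl)

  <-wellFounded : WellFounded _<_
  <-wellFounded = sto⇒wellFounded (proj₁ bft)

  -- The three-point form of the BFT property, with `w = v` allowed and `¬ (u < s)` standing for
  -- `s ≤ u`. The witness is the least vertex with a neighbour outside the predecessors of `v`.
  exchange : ∀ {u v w} → u < v → ¬ (w < v) → E u w → ∃[ s ] (¬ (u < s) × s < v × E s v)
  exchange {u} {v} {w} u<v w≮v uw = go u (<-wellFounded u) u<v (w , uw , w≮v)
    where
    go : ∀ u → Acc _<_ u → u < v → HasNeighbourOutside _<_ v u →
         ∃[ s ] (¬ (u < s) × s < v × E s v)
    go u (acc rec) u<v out
      with ∃? (λ i → i <? u ×-dec ∃? (λ w → E? i w ×-dec ¬? (w <? v)))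
    ... | yes (i , i<u , out′) =
            let (s , i≮s , s<v , sv) = go i (rec i<u) (<-trans i<u u<v) out′
            in s , (λ u<s → i≮s (<-trans i<u u<s)) , s<v , sv
    ... | no none = u , <-irrefl refl , u<v ,
            E-sym (proj₂ bft v u u<v out λ i i<u out′ → none (i , i<u , out′))

  crossing : ∀ {u w k} v → Walk u w k → u < v → ¬ (w < v) → ∃[ s ] (s < v × E s v)
  crossing v nil u<v u≮v = ⊥-elim (u≮v u<v)
  crossing v (cons {v = t} e p) u<v w≮v with t <? v
  ... | yes t<v = crossing v p t<v w≮v
  ... | no  t≮v = let (s , _ , s<v , sv) = exchange u<v t≮v e in s , s<v , sv

  -- `exchange` yields a neighbour `s ≤ u` of `v`. If `s < u`, the edge from `s` to `v` passes over
  -- `u`, so induction connects `s` to `u`.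
  straddled⇒connected : ∀ {u v w} → u < v → ¬ (w < v) → E u w → Connected u v
  straddled⇒connected {u} {v} = go u v (<-wellFounded u)
    where
    go : ∀ u v {w} → Acc _<_ u → u < v → ¬ (w < v) → E u w → Connected u v
    go u v (acc rec) u<v w≮v uw with exchange u<v w≮v uw
    ... | s , u≮s , s<v , sv with compare s u
    ...   | tri< s<u _ _  = connected-trans
              (connected-sym (go s u (rec s<u) s<u (asym u<v) sv)) (adjacent⇒connected sv)
    ...   | tri≈ _ refl _ = adjacent⇒connected sv
    ...   | tri> _ _ u<s  = ⊥-elim (u≮s u<s)

  -- No component starts in the interval (u , v].
  SameComponent : V → V → Set
  SameComponent u v = u ≡ v ⊎ (u < v × (∀ w → u < w → ¬ (v < w) → ∃[ s ] (s < w × E s w)))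

  connected⇒same : ∀ {u v} → ¬ (v < u) → Connected u v → SameComponent u v
  connected⇒same {u} {v} v≮u (_ , p) with compare u v
  ... | tri< u<v _ _ = inj₂ (u<v , λ w u<w v≮w → crossing w p u<w v≮w)
  ... | tri≈ _ u≡v _ = inj₁ u≡v
  ... | tri> _ _ v<u = ⊥-elim (v≮u v<u)

  -- Each `w` in the interval has a smaller neighbour `s`. If `s` is after `u`, induction connects
  -- `u` to `s`; if `s` is before `u`, the edge from `s` to `w` passes over `u` and
  -- `straddled⇒connected` applies.
  same⇒connected : ∀ {u v} → SameComponent u v → Connected u v
  same⇒connected (inj₁ refl) = 0 , nil
  same⇒connected {u} {v} (inj₂ (u<v , nonstart)) =
    go v (<-wellFounded v) u<v (<-irrefl refl)
    where
    go : ∀ w → Acc _<_ w → u < w → ¬ (v < w) → Connected u w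
    go w (acc rec) u<w v≮w with nonstart w u<w v≮w
    ... | s , s<w , sw with compare u s
    ...   | tri< u<s _ _  = connected-trans
              (go s (rec s<w) u<s (λ v<s → v≮w (<-trans v<s s<w))) (adjacent⇒connected sw)
    ...   | tri≈ _ refl _ = adjacent⇒connected sw
    ...   | tri> _ _ s<u  = connected-trans
              (connected-sym (straddled⇒connected s<u (asym u<w) sw)) (adjacent⇒connected sw)

  -- When the order of visit follows the distance from a root, this holds for `u` before `v` on one
  -- level and fails when `v` is at least two levels further. One level apart it can go either way,
  -- hence the exclusion of gap 1.
  LowerNeighbour : V → V → Set
  LowerNeighbour u v = u < v × ∃[ s ] (E s v × s < u)

  SameLevel : V → V → Set
  SameLevel u v = u ≡ v ⊎ LowerNeighbour u v ⊎ LowerNeighbour v u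

  Test : V → V → V → Set
  Test x y z = SameComponent x y × SameComponent x z × SameLevel y z

-- Two copies of a graph joined by one edge, and the search in the copy with the later root

record Linked (g h : Graph) (x : Graph.V g) (near far : Graph.V g → Graph.V h) : Set where
  private
    module g = Graph g
    module h = Graph h
  field
    cover         : ∀ v → (∃[ u ] near u ≡ v) ⊎ (∃[ u ] far u ≡ v)
    near≢far      : ∀ {u v} → near u ≢ far v
    far-injective : ∀ {u v} → far u ≡ far v → u ≡ v
    near-isometry : Isometric g h near
    far-isometry  : Isometric g h far
    near⁻         : ∀ {u v} → h.E (near u) (near v) → g.E u v
    far⁺          : ∀ {u v} → g.E u v → h.E (far u) (far v)
    far⁻          : ∀ {u v} → h.E (far u) (far v) → g.E u v
    link          : h.E (near x) (far x)
    link-unique   : ∀ {u v} → h.E (near u) (far v) → u ≡ x × v ≡ x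

-- Which copy has the earlier root depends on the order, so the roles `near` and `far` are abstract
-- and one analysis serves both cases.
module FarCopy
  {g h : Graph} {x : Graph.V g} {near far : Graph.V g → Graph.V h} (linked : Linked g h x near far)
  (_<_ : Rel (Graph.V h) 0ℓ) (bft : Graph.IsBFT h _<_) (near<far : near x < far x) where
  open Linked linked
  open Graph g renaming (sym to E-sym)
  open FiniteGraph g
  open BFT h _<_ bft
  private
    module h    = Graph h
    module Near = Isometric near-isometry
    module Far  = Isometric far-isometry

  -- Whichever of near c and far v is later lies on a walk leaving the earlier
  -- one for x, hence has a smaller neighbour, in the same copy: infinite descent.
  descent : ∀ {c v} → Acc _<_ (far v) → Acc _<_ (near c) → Connected c x → Connected v x →
    ¬ (near x < near c) → ¬ (far v < far x)
  descent {c} {v} (acc recᵛ) (acc recᶜ) cx vx x≮c v<x with compare (near c) (far v)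
  ... | tri≈ _ c≡v _ = near≢far c≡v
  ... | tri< c<v _ _
    with crossing (far v) (FiniteGraph.snoc h (Near.walk⁺ (proj₂ cx)) link) c<v (asym v<x)
  ...   | s , s<v , sv with cover s
  ...     | inj₁ (c′ , refl) with link-unique sv
  ...       | _ , refl = <-irrefl refl v<x
  descent {c} {v} (acc recᵛ) (acc recᶜ) cx vx x≮c v<x | tri< c<v _ _ | s , s<v , sv
          | inj₂ (v′ , refl) =
            descent (recᵛ s<v) (acc recᶜ) cx
              (connected-trans (adjacent⇒connected (far⁻ sv)) vx) x≮c (<-trans s<v v<x)
  descent {c} {v} (acc recᵛ) (acc recᶜ) cx vx x≮c v<x | tri> _ _ v<c
    with crossing (near c) (Far.walk⁺ (proj₂ vx)) v<c
           (λ x<c → x≮c (<-trans near<far x<c))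
  ...   | s , s<c , sc with cover s
  ...     | inj₁ (c′ , refl) =
            descent (acc recᵛ) (recᶜ s<c)
              (connected-trans (adjacent⇒connected (near⁻ sc)) cx) vx
              (λ x<c′ → x≮c (<-trans x<c′ s<c)) v<x
  ...     | inj₂ (v′ , refl) with link-unique (h.sym sc)
  ...       | refl , refl = asym near<far s<c

  -- `descent` started at `c = x`. It makes `far x` the root of the far copy of its component, from
  -- which levels are counted.
  far-least : ∀ {v} → Connected v x → ¬ (far v < far x)
  far-least vx = descent (<-wellFounded _) (<-wellFounded _) (0 , nil) vx (<-irrefl refl)

  -- Induction along the walk from `u`. When its next vertex `u₀` comes before `v`, `exchange` gives
  -- `v` a neighbour no later than `u₀`, whose distance is bounded by induction. So the order of
  -- visit follows the distance from `far x`.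
  levels : ∀ {u v n} → Walk u x n → Connected v x → ¬ (far u < far v) →
    ∃[ m ] (m ≤ n × Walk v x m)
  levels {v = v} nil vx x≮v with compare (far x) (far v)
  ... | tri< x<v _ _ = ⊥-elim (x≮v x<v)
  ... | tri> _ _ v<x = ⊥-elim (far-least vx v<x)
  ... | tri≈ _ x≡v _ with far-injective x≡v
  ...   | refl = 0 , z≤n , nil
  levels {v = v} (cons {v = u₀} e p) vx u≮v with far u₀ <? far v
  ... | no u₀≮v = let (m , m≤n , q) = levels p vx u₀≮v in m , ℕ.m≤n⇒m≤1+n m≤n , q
  ... | yes u₀<v with exchange u₀<v u≮v (far⁺ (E-sym e))
  ...   | s , u₀≮s , _ , sv with cover s
  ...     | inj₂ (c , refl) =
            let vc             = E-sym (far⁻ sv)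
                (m , m≤n , q)  = levels p (connected-trans (adjacent⇒connected (E-sym vc)) vx) u₀≮s
            in suc m , s≤s m≤n , cons vc q
  ...     | inj₁ (c , refl) with link-unique sv
  ...       | refl , refl = 0 , z≤n , nil

  -- By `levels`, `y` before `z` gives `α ≤ β`. The neighbour `s` of `z` comes before `y`, so its
  -- distance is at most `α`, and `z` is at most one step further.
  lower⇒levels : ∀ {y z α β} → d[ y , x ]≡ α → d[ z , x ]≡ β →
    LowerNeighbour (far y) (far z) → α ≤ β × β ≤ suc α
  lower⇒levels {y} {z} (py , miny) (pz , minz) (y<z , s , sz , s<y) =
    (let (m , m≤β , q) = levels pz (_ , py) (asym y<z) in ℕ.≤-trans (miny m q) m≤β) ,
    upper (cover s)
    where
    upper : (∃[ u ] near u ≡ s) ⊎ (∃[ u ] far u ≡ s) → _ ≤ _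
    -- A near neighbour would force `z` to be `x`, but `y` cannot precede the root.
    upper (inj₁ (c , refl)) with link-unique sz
    ... | refl , refl = ⊥-elim (far-least (_ , py) y<z)
    upper (inj₂ (c , refl)) =
      let cz            = far⁻ sz
          (m , m≤α , q) = levels py (_ , cons cz pz) (asym s<y)
      in ℕ.≤-trans (minz (suc m) (cons (E-sym cz) q)) (s≤s m≤α)

  -- The witness is the second vertex `w` of a shortest walk from `z` to `x`. Were `w` not before
  -- `y`, `levels` would put `y` within distance `k - 1`. For `k = 0`, `z` is the root, which `y`
  -- cannot precede.
  equidistant⇒lower : ∀ {y z k} → d[ y , x ]≡ k → d[ z , x ]≡ k → far y < far z →
    LowerNeighbour (far y) (far z)
  equidistant⇒lower (py , _) (nil , _) y<z = ⊥-elim (far-least (_ , py) y<z)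
  equidistant⇒lower {y} (py , miny) (cons {v = w} e p , _) y<z with far w <? far y
  ... | yes w<y = y<z , far w , far⁺ (E-sym e) , w<y
  ... | no  w≮y = let (m , m≤k , q) = levels p (_ , py) w≮y in
                  ⊥-elim (ℕ.<⇒≱ (s≤s m≤k) (miny m q))

  equidistant⇒test : ∀ {y z} → EquidistantFrom x y z → Test (far x) (far y) (far z)
  equidistant⇒test {y} {z} (k , dy , dz) = same dy , same dz , level
    where
    same : ∀ {v} → d[ x , v ]≡ k → SameComponent (far x) (far v)
    same (p , _) = connected⇒same (far-least (_ , reverse p)) (_ , Far.walk⁺ p)

    level : SameLevel (far y) (far z)
    level with compare (far y) (far z)
    ... | tri< y<z _ _ = inj₂ (inj₁ (equidistant⇒lower (distance-sym dy) (distance-sym dz) y<z))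
    ... | tri≈ _ y≡z _ = inj₁ y≡z
    ... | tri> _ _ z<y = inj₂ (inj₂ (equidistant⇒lower (distance-sym dz) (distance-sym dy) z<y))

  module _ {y z : V} (no-gap : ∀ {a b} → d[ x , y ]≡ a → d[ x , z ]≡ b → ∣ a - b ∣ ≢ 1) where

    -- `lower⇒levels` leaves the distances equal or one apart, and `no-gap` rules out the latter.
    test⇒equidistant : Test (far x) (far y) (far z) → EquidistantFrom x y z
    test⇒equidistant (sy , sz , level) =
      let (α , dy) = distance (Far.connected⁻ (same⇒connected sy))
          (β , dz) = distance (Far.connected⁻ (same⇒connected sz))
      in α , dy , subst (d[ x , z ]≡_) (sym (equal dy dz level)) dz
      where
      close : ∀ {a b} → a ≤ b × b ≤ suc a → ∣ a - b ∣ ≢ 1 → a ≡ b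
      close {a} (a≤b , b≤1+a) gap with ℕ.m≤n⇒m<n∨m≡n a≤b
      ... | inj₂ a≡b = a≡b
      ... | inj₁ a<b with ℕ.≤-antisym b≤1+a a<b
      ...   | refl = ⊥-elim (gap (trans (cong ∣ a -_∣ (ℕ.+-comm 1 a)) (ℕ.∣m-m+n∣≡n a 1)))

      equal : ∀ {α β} → d[ x , y ]≡ α → d[ x , z ]≡ β → SameLevel (far y) (far z) → α ≡ β
      equal dy dz (inj₁ y≡z) with far-injective y≡z
      ... | refl = distance-unique dy dz
      equal dy dz (inj₂ (inj₁ low)) =
        close (lower⇒levels (distance-sym dy) (distance-sym dz) low) (no-gap dy dz)
      equal {α} {β} dy dz (inj₂ (inj₂ low)) = sym
        (close (lower⇒levels (distance-sym dz) (distance-sym dy) low)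
          (λ gap → no-gap dy dz (trans (ℕ.∣-∣-comm α β) gap)))

-- The doubled graph

module Doubled (g : Graph) (x y z : Graph.V g) where
  open Graph g renaming (sym to E-sym)

  G : PointedGraph 3
  G = record { graph = g ; points = x ∷ y ∷ z ∷ [] }

  h : Graph
  h = PointedGraph.graph (G ^τ)

  private module h = Graph h

  fold : V ⊎ V → V
  fold (inj₁ u) = u
  fold (inj₂ u) = u

  fold-edge : ∀ u v → Eτ G u v → fold u ≡ fold v ⊎ E (fold u) (fold v)
  fold-edge (inj₁ u) (inj₁ v) e             = inj₂ e
  fold-edge (inj₁ u) (inj₂ v) (refl , refl) = inj₁ refl
  fold-edge (inj₂ u) (inj₁ v) (refl , refl) = inj₁ refl
  fold-edge (inj₂ u) (inj₂ v) e             = inj₂ e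

  -- An edge within a copy survives folding and the linking edge collapses to a vertex. As `fold`
  -- undoes `inj₁` and `inj₂`, both inclusions are isometric.
  fold-walk : ∀ {u v k} → h.Walk u v k → ∃[ m ] (m ≤ k × Walk (fold u) (fold v) m)
  fold-walk h.nil = 0 , z≤n , nil
  fold-walk {v = v} (h.cons {u = u} {v = w} e p) with fold-edge u w e | fold-walk p
  ... | inj₁ u≡w | m , m≤k , q =
          m , ℕ.m≤n⇒m≤1+n m≤k , subst (λ t → Walk t (fold v) m) (sym u≡w) q
  ... | inj₂ uw  | m , m≤k , q = suc m , s≤s m≤k , cons uw q

  inj₁-walk : ∀ {u v k} → Walk u v k → h.Walk (inj₁ u) (inj₁ v) k
  inj₁-walk nil        = h.nil
  inj₁-walk (cons e p) = h.cons e (inj₁-walk p)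

  inj₂-walk : ∀ {u v k} → Walk u v k → h.Walk (inj₂ u) (inj₂ v) k
  inj₂-walk nil        = h.nil
  inj₂-walk (cons e p) = h.cons e (inj₂-walk p)

  inj₁-isometry : Isometric g h inj₁
  inj₁-isometry = record { walk⁺ = inj₁-walk ; walk⁻ = fold-walk }

  inj₂-isometry : Isometric g h inj₂
  inj₂-isometry = record { walk⁺ = inj₂-walk ; walk⁻ = fold-walk }

  linked₁₂ : Linked g h x inj₁ inj₂
  linked₁₂ = record
    { cover         = λ { (inj₁ u) → inj₁ (u , refl) ; (inj₂ u) → inj₂ (u , refl) }
    ; near≢far      = λ ()
    ; far-injective = inj₂-injective
    ; near-isometry = inj₁-isometry
    ; far-isometry  = inj₂-isometry
    ; near⁻         = λ e → e
    ; far⁺          = λ e → e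
    ; far⁻          = λ e → e
    ; link          = refl , refl
    ; link-unique   = λ e → e
    }

  linked₂₁ : Linked g h x inj₂ inj₁
  linked₂₁ = record
    { cover         = λ { (inj₁ u) → inj₂ (u , refl) ; (inj₂ u) → inj₁ (u , refl) }
    ; near≢far      = λ ()
    ; far-injective = inj₁-injective
    ; near-isometry = inj₂-isometry
    ; far-isometry  = inj₁-isometry
    ; near⁻         = λ e → e
    ; far⁺          = λ e → e
    ; far⁻          = λ e → e
    ; link          = refl , refl
    ; link-unique   = λ e → e
    }

-- The first-order sentence and its correctness

sameComponent : Fin 6 → Fin 6 → Sentence 6
sameComponent u v =
  const u ≐ const v ∨̇
  const u ≺ const v ∧̇
    ∀̇ (const u ≺ var 0F ⇒̇ ¬̇ (const v ≺ var 0F) ⇒̇ ∃̇ (var 0F ≺ var 1F ∧̇ var 0F ~ var 1F))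

lowerNeighbour : Fin 6 → Fin 6 → Sentence 6
lowerNeighbour u v = const u ≺ const v ∧̇ ∃̇ (var 0F ~ const v ∧̇ var 0F ≺ const u)

-- Follows `Test` clause by clause, so that satisfaction in `G ^τ` unfolds to `Test` without
-- translation.
test : Fin 6 → Fin 6 → Fin 6 → Sentence 6
test x y z =
  sameComponent x y ∧̇ sameComponent x z ∧̇
  (const y ≐ const z ∨̇ lowerNeighbour y z ∨̇ lowerNeighbour z y)

equidistance : Sentence 6
equidistance = (const 0F ≺ const 3F ∧̇ test 3F 4F 5F) ∨̇ (const 3F ≺ const 0F ∧̇ test 0F 1F 2F)

-- The right-hand side does not mention the order, so this also gives independence of the choice of
-- BFT.
equidistance-correct : ∀ G → 𝒢′₃ G → ∀ _<_ → PointedGraph.IsBFT (G ^τ) _<_ →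
  (G ^τ , _<_ ⊨ equidistance) ⇔ Equidistant G
equidistance-correct record { graph = g ; points = x ∷ y ∷ z ∷ [] } G∈𝒢′₃ _<_ bft = mk⇔ to from
  where
  open Doubled g x y z
  open Graph g using (d[_,_]≡_)

  no-gap : ∀ {a b} → d[ x , y ]≡ a → d[ x , z ]≡ b → ∣ a - b ∣ ≢ 1
  no-gap dy dz gap = G∈𝒢′₃ ((_ , proj₁ dy) , (_ , proj₁ dz)) (_ , _ , dy , dz , gap)

  to : (G ^τ , _<_ ⊨ equidistance) → Equidistant G
  to (inj₁ (x₁<x₂ , t)) = FarCopy.test⇒equidistant linked₁₂ _<_ bft x₁<x₂ no-gap t
  to (inj₂ (x₂<x₁ , t)) = FarCopy.test⇒equidistant linked₂₁ _<_ bft x₂<x₁ no-gap t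

  from : Equidistant G → (G ^τ , _<_ ⊨ equidistance)
  from eq with BFT.compare h _<_ bft (inj₁ x) (inj₂ x)
  ... | tri< x₁<x₂ _ _ = inj₁ (x₁<x₂ , FarCopy.equidistant⇒test linked₁₂ _<_ bft x₁<x₂ eq)
  ... | tri> _ _ x₂<x₁ = inj₂ (x₂<x₁ , FarCopy.equidistant⇒test linked₂₁ _<_ bft x₂<x₁ eq)

-- Invariance under isomorphism

Equidistant₆ : PointedGraph 6 → Set
Equidistant₆ H =
  FiniteGraph.EquidistantFrom graph (Vec.lookup points 0F) (Vec.lookup points 1F) (Vec.lookup points 2F)
  where open PointedGraph H

-- An isomorphism of doubled graphs is not given as one of the original graphs. Equidistance is
-- therefore moved into the first copy inside `G ^τ`, where it transfers along any isomorphism.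
equidistant-τ : ∀ G → Equidistant G ⇔ Equidistant₆ (G ^τ)
equidistant-τ record { graph = g ; points = x ∷ y ∷ z ∷ [] } =
  Isometric.equidistant (Doubled.inj₁-isometry g x y z)

≅-isometry : ∀ {n} {H H′ : PointedGraph n} (iso : H ≅ H′) →
  Isometric (PointedGraph.graph H) (PointedGraph.graph H′) (Inverse.to (_≅_.bijection iso))
≅-isometry {H = H} {H′} iso = record
  { walk⁺ = walk⁺
  ; walk⁻ = λ {u} {v} p → _ , ℕ.≤-refl ,
      subst₂ (λ a b → H.Walk a b _) (strictlyInverseʳ u) (strictlyInverseʳ v) (walk⁻ p)
  }
  where
  module H  = PointedGraph H
  module H′ = PointedGraph H′
  open _≅_ iso
  open Inverse bijection

  walk⁺ : ∀ {u v k} → H.Walk u v k → H′.Walk (to u) (to v) k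
  walk⁺ H.nil        = H′.nil
  walk⁺ (H.cons e p) = H′.cons (Equivalence.to (edges _ _) e) (walk⁺ p)

  walk⁻ : ∀ {u v k} → H′.Walk u v k → H.Walk (from u) (from v) k
  walk⁻ H′.nil = H.nil
  walk⁻ (H′.cons {u = u} {v = v} e p) = H.cons
    (Equivalence.from (edges _ _)
      (subst₂ H′.E (sym (strictlyInverseˡ u)) (sym (strictlyInverseˡ v)) e))
    (walk⁻ p)

≅-point : ∀ {n} {H H′ : PointedGraph n} (iso : H ≅ H′) i →
  Vec.lookup (PointedGraph.points H′) i ≡
  Inverse.to (_≅_.bijection iso) (Vec.lookup (PointedGraph.points H) i)
≅-point {H = H} iso i =
  trans (cong (λ ps → Vec.lookup ps i) (sym (_≅_.constants iso)))
        (lookup-map i _ (PointedGraph.points H))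

equidistant-≅ : ∀ {H H′} → H ≅ H′ → Equidistant₆ H ⇔ Equidistant₆ H′
equidistant-≅ iso rewrite ≅-point iso 0F | ≅-point iso 1F | ≅-point iso 2F =
  Isometric.equidistant (≅-isometry iso)

equidistance-invariant : Invariant equidistance
equidistance-invariant _ _<_ _ _<′_ (image G G∈ , bft) (image G′ G′∈ , bft′) iso =
  ⇔-trans (equidistance-correct G G∈ _<_ bft)
  (⇔-trans (equidistant-τ G)
  (⇔-trans (equidistant-≅ iso)
  (⇔-trans (⇔-sym (equidistant-τ G′))
  (⇔-sym (equidistance-correct G′ G′∈ _<′_ bft′)))))

theorem1 : ∃[ ψ ] (Invariant ψ ×
    (∀ G → 𝒢′₃ G →
    (InOneComponent G × Equidistant G → (G ^τ) ⊨𝔅 ψ) ×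
    ((¬ InOneComponent G) ⊎ (∃[ k ] (DistanceGap G k × 2 ≤ k)) → ¬ ((G ^τ) ⊨𝔅 ψ))))
theorem1 = equidistance , equidistance-invariant , λ G G∈ → holds G G∈ , fails G G∈
  where
  holds : ∀ G → 𝒢′₃ G → InOneComponent G × Equidistant G → (G ^τ) ⊨𝔅 equidistance
  holds G G∈ (_ , eq) with Existence.bft-exists (PointedGraph.graph (G ^τ))
  ... | _<_ , bft = _<_ , bft , Equivalence.from (equidistance-correct G G∈ _<_ bft) eq

  fails : ∀ G → 𝒢′₃ G → (¬ InOneComponent G) ⊎ (∃[ k ] (DistanceGap G k × 2 ≤ k)) →
    ¬ ((G ^τ) ⊨𝔅 equidistance)
  fails G G∈ far (_<_ , bft , sat) with Equivalence.to (equidistance-correct G G∈ _<_ bft) sat | far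
  ... | k , (p , _) , (q , _) | inj₁ apart = apart ((k , p) , (k , q))
  -- Distances are unique, so equidistance makes the gap 0.
  ... | k , dy , dz | inj₂ (_ , (a , b , dy′ , dz′ , refl) , 2≤gap) =
    ℕ.<⇒≱ 2≤gap (ℕ.≤-trans (ℕ.≤-reflexive gap≡0) z≤n)
    where
    open FiniteGraph (PointedGraph.graph G)

    gap≡0 : ∣ a - b ∣ ≡ 0
    gap≡0 = ℕ.m≡n⇒∣m-n∣≡0 (trans (distance-unique dy′ dy) (distance-unique dz dz′))
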